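{- There exists a finite graph $G$ which is $P_{6}$-induced-saturated.
   Context: $P_n$ denotes the path on $n$ vertices. A (simple) graph $G$ is called $H$-induced-saturated if (i) $G$ does not contain an induced subgraph isomorphic to $H$; (ii) for every edge $e\in E(G)$, the graph $G-e$ obtained by deleting $e$ contains an induced subgraph isomorphic to $H$; and (iii) for every pair $\{x,y\}$ of distinct non-adjacent vertices of $G$, the graph $G+xy$ obtained by adding the edge $xy$ contains an induced subgraph isomorphic to $H$. -}

module Defs where

open import Data.Nat.Base using (ℕ; suc)
import Data.Nat.Properties as ℕ
open import Data.Fin.Base using (Fin; toℕ)
open import Data.Fin.Properties using (_≟_)
open import Data.Fin.Subset using (Subset; _∈_)
open import Data.Product.Base using (Σ-syntax; ∃-syntax; _×_; _,_; proj₁; proj₂)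
open import Data.Sum.Base using (_⊎_; inj₁; inj₂; swap; [_,_]′; map)
open import Function.Base using (_∘_)
open import Function.Bundles using (_↔_; _⇔_; Inverse)
open import Relation.Binary.Core using (Rel)
open import Relation.Binary.Definitions using (Symmetric; Irreflexive; Decidable)
open import Relation.Binary.PropositionalEquality using (_≡_; _≢_; refl; sym; trans)
open import Relation.Nullary using (¬_; Dec)
open import Relation.Nullary.Decidable using (_×-dec_; _⊎-dec_; ¬?)
open import Level using (0ℓ)

-- Decidability of adjacency is part of the data: classically it is no
-- restriction, and it makes these the usual finite graphs when V is finite.
record SimpleGraph (V : Set) : Set₁ where
  field
    Adj    : Rel V 0ℓ
    symm   : Symmetric Adj
    irrefl : Irreflexive _≡_ Adj
    adj?   : Decidable Adj

open SimpleGraph public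

FiniteGraph : ℕ → Set₁
FiniteGraph n = SimpleGraph (Fin n)

record _≅_ {V W : Set} (G : SimpleGraph V) (H : SimpleGraph W) : Set where
  field
    vertices : V ↔ W
    edges    : ∀ u v → Adj G u v ⇔ Adj H (Inverse.to vertices u) (Inverse.to vertices v)

Path : ∀ n → FiniteGraph n
Path n .Adj i j = suc (toℕ i) ≡ toℕ j ⊎ suc (toℕ j) ≡ toℕ i
Path n .symm = swap
Path n .irrefl refl = [ ℕ.1+n≢n , ℕ.1+n≢n ]′
Path n .adj? i j = (suc (toℕ i) ℕ.≟ toℕ j) ⊎-dec (suc (toℕ j) ℕ.≟ toℕ i)

module _ {n : ℕ} where

  induced : FiniteGraph n → (S : Subset n) → SimpleGraph (∃[ v ] v ∈ S)
  induced G S .Adj u v = Adj G (proj₁ u) (proj₁ v)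
  induced G S .symm = symm G
  induced G S .irrefl refl = irrefl G refl
  induced G S .adj? u v = adj? G (proj₁ u) (proj₁ v)

  ContainsInduced : {W : Set} → FiniteGraph n → SimpleGraph W → Set
  ContainsInduced G H = Σ[ S ∈ Subset n ] induced G S ≅ H

  -- Equality of the unordered pairs {u, v} and {x, y}.
  SamePair : (u v x y : Fin n) → Set
  SamePair u v x y = (u ≡ x × v ≡ y) ⊎ (u ≡ y × v ≡ x)

  samePair-swap : ∀ {u v x y} → SamePair u v x y → SamePair v u x y
  samePair-swap (inj₁ (p , q)) = inj₂ (q , p)
  samePair-swap (inj₂ (p , q)) = inj₁ (q , p)

  samePair? : ∀ u v x y → Dec (SamePair u v x y)
  samePair? u v x y = ((u ≟ x) ×-dec (v ≟ y)) ⊎-dec ((u ≟ y) ×-dec (v ≟ x))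

  samePair-loop : ∀ {u x y} → SamePair u u x y → x ≡ y
  samePair-loop (inj₁ (p , q)) = trans (sym p) q
  samePair-loop (inj₂ (p , q)) = trans (sym q) p

  deleteEdge : FiniteGraph n → (x y : Fin n) → FiniteGraph n
  deleteEdge G x y .Adj u v = Adj G u v × ¬ SamePair u v x y
  deleteEdge G x y .symm (a , d) = symm G a , d ∘ samePair-swap
  deleteEdge G x y .irrefl eq (a , _) = irrefl G eq a
  deleteEdge G x y .adj? u v = adj? G u v ×-dec ¬? (samePair? u v x y)

  addEdge : FiniteGraph n → (x y : Fin n) → x ≢ y → FiniteGraph n
  addEdge G x y x≢y .Adj u v = Adj G u v ⊎ SamePair u v x y
  addEdge G x y x≢y .symm = map (symm G) samePair-swap
  addEdge G x y x≢y .irrefl refl = [ irrefl G refl , x≢y ∘ samePair-loop ]′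
  addEdge G x y x≢y .adj? u v = adj? G u v ⊎-dec samePair? u v x y

  record InducedSaturated {W : Set} (H : SimpleGraph W) (G : FiniteGraph n) : Set where
    field
      induced-free : ¬ ContainsInduced G H
      delete       : ∀ x y → Adj G x y → ContainsInduced (deleteEdge G x y) H
      add          : ∀ x y (x≢y : x ≢ y) → ¬ Adj G x y →
                     ContainsInduced (addEdge G x y x≢y) H

{-# OPTIONS --safe #-}
-- The Clebsch graph works: it is the Cayley graph of 𝔽₂⁴ on the connection set
-- {a, b, c, d, e} = {e₁, e₂, e₃, e₄, e₁ + e₂ + e₃ + e₄}, whose only linear
-- relation is a + b + c + d + e = 0.  A path is a word in these letters, and it
-- is induced only if any three consecutive letters are distinct and no four
-- are (their sum would be the fifth letter).  Hence a five-letter word would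
-- have the form abcab, but then its ends differ by c and are adjacent.
-- Deleting that edge makes the word abcab an induced P₆.  Adding the edge
-- {x, x + a + b} makes the step a + b followed by the word cadc an induced P₆.
-- Since the graph is finite, it suffices to evaluate a search for induced paths
-- that abandons a partial path as soon as it fails to be induced.
module Submission where

open import Defs
open import Data.Bool.Base using (T; true; false)
open import Data.Fin.Base using (Fin; zero; suc)
open import Data.Fin.Properties using (_≟_; all?; any?; suc-injective)
open import Data.Fin.Subset using (Subset; _∈_)
open import Data.Fin.Subset.Properties using (_∈?_)
open import Data.List.Base using (List; []; _∷_)
open import Data.List.Relation.Unary.All as All using (All; []; _∷_)
open import Data.Nat.Base using (ℕ; zero; suc; _≤_; s≤s; z≤n)
import Data.Nat.Properties as ℕ
open import Data.Product.Base using (Σ-syntax; ∃-syntax; _×_; _,_; proj₁; proj₂)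
open import Data.Sum.Base using (inj₁; inj₂)
import Data.Sum.Base as Sum
open import Data.Unit.Base using (⊤; tt)
open import Data.Vec.Base using (Vec; []; _∷_; tabulate; lookup)
import Data.Vec.Functional as Functional
open import Data.Vec.Properties using (lookup∘tabulate; lookup⇒[]=; []=⇒lookup)
open import Data.Vec.Properties.WithK using ([]=-irrelevant)
open import Function.Base using (_∘_; _$_)
open import Function.Bundles using (_⇔_; mk⇔; mk↔ₛ′; Equivalence; Inverse)
open import Function.Definitions using (Injective)
open import Relation.Binary.PropositionalEquality
  using (_≡_; _≢_; refl; sym; trans; cong; subst; subst₂; ≢-sym)
open import Relation.Nullary using (¬_; Dec; yes; no; does; contradiction)
open import Relation.Nullary.Decidable
  using (_×-dec_; _→-dec_; ¬?; map′; from-yes; from-no; dec-true; toWitness; isYes≗does)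

open Equivalence using (to; from)

-- A map, unlike a subset with an isomorphism, lets a path be built and taken apart one vertex at a
-- time.
record IsInducedEmbedding {m n} (H : FiniteGraph m) (G : FiniteGraph n)
                          (f : Fin m → Fin n) : Set where
  field
    injective : Injective _≡_ _≡_ f
    edges     : ∀ i j → Adj G (f i) (f j) ⇔ Adj H i j

open IsInducedEmbedding

module _ {m n : ℕ} {H : FiniteGraph m} {G : FiniteGraph n} where

  ∈-subset-≡ : ∀ {S : Subset n} {u v : ∃[ w ] w ∈ S} → proj₁ u ≡ proj₁ v → u ≡ v
  ∈-subset-≡ {u = _ , p} {v = _ , q} refl = cong (_ ,_) ([]=-irrelevant p q)

  embedding⇒contains : ∀ {f} → IsInducedEmbedding H G f → ContainsInduced G H
  embedding⇒contains {f} emb = image , record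
    { vertices = mk↔ₛ′ (proj₁ ∘ preimage)
        (λ i → f i , ∈-image i)
        (λ i → injective emb (proj₂ (preimage (f i , ∈-image i))))
        (λ u → ∈-subset-≡ (proj₂ (preimage u)))
    ; edges = λ u v → subst₂ (λ x y → Adj G x y ⇔ Adj H (proj₁ (preimage u)) (proj₁ (preimage v)))
        (proj₂ (preimage u)) (proj₂ (preimage v))
        (edges emb (proj₁ (preimage u)) (proj₁ (preimage v)))
    }
    where
    inImage? : ∀ v → Dec (∃[ i ] f i ≡ v)
    inImage? v = any? λ i → f i ≟ v

    image : Subset n
    image = tabulate (does ∘ inImage?)

    ∈-image : ∀ i → f i ∈ image
    ∈-image i = lookup⇒[]= (f i) image
      (trans (lookup∘tabulate _ (f i)) (dec-true (inImage? (f i)) (i , refl)))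

    preimage : ((v , _) : ∃[ v ] v ∈ image) → ∃[ i ] f i ≡ v
    -- Membership says that the tabulated Boolean is `true`, so the decision at `v` must carry a
    -- preimage.
    preimage (v , v∈) = toWitness {a? = inImage? v} $ subst T
      (sym (trans (isYes≗does (inImage? v)) (trans (sym (lookup∘tabulate _ v)) ([]=⇒lookup v∈)))) tt

  contains⇒embedding : ContainsInduced G H → ∃[ f ] IsInducedEmbedding H G f
  contains⇒embedding (S , iso) = proj₁ ∘ φ.from , record
    { injective = λ {i} {j} eq → trans (sym (φ.strictlyInverseˡ i))
        (trans (cong φ.to (∈-subset-≡ eq)) (φ.strictlyInverseˡ j))
    ; edges = λ i j → subst₂ (λ k l → Adj G (proj₁ (φ.from i)) (proj₁ (φ.from j)) ⇔ Adj H k l)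
        (φ.strictlyInverseˡ i) (φ.strictlyInverseˡ j)
        (_≅_.edges iso (φ.from i) (φ.from j))
    }
    where module φ = Inverse (_≅_.vertices iso)

module InducedPaths {n : ℕ} (G : FiniteGraph n) where

  Away : Fin n → Fin n → Set
  Away u v = u ≢ v × ¬ Adj G u v

  away-sym : ∀ {u v} → Away u v → Away v u
  away-sym (u≢v , u≁v) = ≢-sym u≢v , u≁v ∘ symm G

  -- The path traversed so far ends in v, and ws lists its earlier vertices.
  Continues : ℕ → (v : Fin n) (ws : List (Fin n)) → Set
  Continues zero    v ws = ⊤
  Continues (suc k) v ws =
    ∃[ w ] Adj G v w × All (Away w) ws × Continues k w (v ∷ ws)

  continues? : ∀ k v ws → Dec (Continues k v ws)
  continues? zero    v ws = yes tt
  continues? (suc k) v ws = any? λ w →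
    -- The recursive call stands last, so a `w` that fails an earlier test is rejected without it.
    adj? G v w ×-dec All.all? (λ u → ¬? (w ≟ u) ×-dec ¬? (adj? G w u)) ws
      ×-dec continues? k w (v ∷ ws)

  HasPath : ℕ → Set
  HasPath k = ∃[ v ] Continues k v []

  hasPath? : ∀ k → Dec (HasPath k)
  hasPath? k = any? λ v → continues? k v []

  embedding-tail : ∀ {k f} → IsInducedEmbedding (Path (suc k)) G f →
                   IsInducedEmbedding (Path k) G (f ∘ suc)
  embedding-tail emb .injective = suc-injective ∘ injective emb
  embedding-tail emb .edges i j = mk⇔
    (Sum.map ℕ.suc-injective ℕ.suc-injective ∘ to (edges emb (suc i) (suc j)))
    (from (edges emb (suc i) (suc j)) ∘ Sum.map (cong suc) (cong suc))

  -- Induction on the length: dropping the first vertex moves it into `ws`. The hypothesis omits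
  -- `f zero`, which may be adjacent to the latest entry of `ws`.
  embedding⇒continues : ∀ k {f ws} → IsInducedEmbedding (Path (suc k)) G f →
    (∀ i → All (Away (f (suc i))) ws) → Continues k (f zero) ws
  embedding⇒continues zero    emb away = tt
  embedding⇒continues (suc k) emb away =
    _ , from (edges emb zero (suc zero)) (inj₁ refl) , away zero ,
    embedding⇒continues k (embedding-tail emb)
      -- Positions from 2 onwards are neither equal nor consecutive to position 0.
      (λ i → ((λ ()) ∘ injective emb ,
              (λ { (inj₁ ()) ; (inj₂ ()) }) ∘ to (edges emb (suc (suc i)) zero))
             ∷ away (suc i))

  ∷-embedding : ∀ {k v f} → IsInducedEmbedding (Path (suc k)) G f →
    Adj G v (f zero) → (∀ i → Away (f (suc i)) v) →
    IsInducedEmbedding (Path (suc (suc k))) G (v Functional.∷ f)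
  ∷-embedding {k} {v} {f} emb v~f₀ away = record { injective = inj ; edges = edg }
    where
    v≢f : ∀ i → v ≢ f i
    -- `away` does not cover `f zero`; here adjacency itself excludes equality.
    v≢f zero    v≡f₀ = irrefl G v≡f₀ v~f₀
    v≢f (suc i) = proj₁ (away-sym (away i))

    inj : Injective _≡_ _≡_ (v Functional.∷ f)
    inj {zero}  {zero}  eq = refl
    inj {zero}  {suc j} eq = contradiction eq (v≢f j)
    inj {suc i} {zero}  eq = contradiction (sym eq) (v≢f i)
    inj {suc i} {suc j} eq = cong suc (injective emb eq)

    edg : ∀ i j → Adj G ((v Functional.∷ f) i) ((v Functional.∷ f) j)
                  ⇔ Adj (Path (suc (suc k))) i j
    edg zero    zero          = mk⇔ (λ v~v → contradiction v~v (irrefl G refl))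
                                    (λ { (inj₁ ()) ; (inj₂ ()) })
    edg zero    (suc zero)    = mk⇔ (λ _ → inj₁ refl) (λ _ → v~f₀)
    edg (suc zero) zero       = mk⇔ (λ _ → inj₂ refl) (λ _ → symm G v~f₀)
    edg zero    (suc (suc j)) = mk⇔ (λ v~f → contradiction v~f (proj₂ (away-sym (away j))))
                                    (λ { (inj₁ ()) ; (inj₂ ()) })
    edg (suc (suc i)) zero    = mk⇔ (λ f~v → contradiction f~v (proj₂ (away i)))
                                    (λ { (inj₁ ()) ; (inj₂ ()) })
    edg (suc i) (suc j)       = mk⇔
      (Sum.map (cong suc) (cong suc) ∘ to (edges emb i j))
      (from (edges emb i j) ∘ Sum.map ℕ.suc-injective ℕ.suc-injective)

  -- The last two conjuncts of the pair list carry the induction: `v` joins the earlier vertices of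
  -- the rest, so the head of its `away` allows prepending `v` and the tail covers `ws`.
  continues⇒embedding : ∀ k {v ws} → Continues k v ws →
    ∃[ f ] f zero ≡ v × IsInducedEmbedding (Path (suc k)) G f
           × (∀ i → All (Away (f (suc i))) ws)
  continues⇒embedding zero {v} _ = (λ _ → v) , refl , record
    { injective = λ { {zero} {zero} _ → refl }
    ; edges     = λ { zero zero → mk⇔ (λ v~v → contradiction v~v (irrefl G refl))
                                      (λ { (inj₁ ()) ; (inj₂ ()) }) }
    } , λ ()
  continues⇒embedding (suc k) {v} {ws} (w , v~w , awayw , rest)
    with continues⇒embedding k rest
  ... | f , refl , emb , away =
    v Functional.∷ f , refl , ∷-embedding emb v~w (All.head ∘ away) ,
    λ { zero → awayw ; (suc i) → All.tail (away i) }

  hasPath⇒contains : ∀ k → HasPath k → ContainsInduced G (Path (suc k))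
  hasPath⇒contains k (_ , path) =
    embedding⇒contains (proj₁ (proj₂ (proj₂ (continues⇒embedding k path))))

  contains⇒hasPath : ∀ k → ContainsInduced G (Path (suc k)) → HasPath k
  contains⇒hasPath k sub with contains⇒embedding sub
  ... | f , emb = f zero , embedding⇒continues k emb (λ _ → [])

open InducedPaths

-- Row x marks the y with x xor y ∈ {1, 2, 4, 8, 15}, reading 𝔽₂⁴ in binary.
neighbours : Vec (Subset 16) 16
neighbours =
    (O ∷ I ∷ I ∷ O ∷ I ∷ O ∷ O ∷ O ∷ I ∷ O ∷ O ∷ O ∷ O ∷ O ∷ O ∷ I ∷ [])
  ∷ (I ∷ O ∷ O ∷ I ∷ O ∷ I ∷ O ∷ O ∷ O ∷ I ∷ O ∷ O ∷ O ∷ O ∷ I ∷ O ∷ [])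
  ∷ (I ∷ O ∷ O ∷ I ∷ O ∷ O ∷ I ∷ O ∷ O ∷ O ∷ I ∷ O ∷ O ∷ I ∷ O ∷ O ∷ [])
  ∷ (O ∷ I ∷ I ∷ O ∷ O ∷ O ∷ O ∷ I ∷ O ∷ O ∷ O ∷ I ∷ I ∷ O ∷ O ∷ O ∷ [])
  ∷ (I ∷ O ∷ O ∷ O ∷ O ∷ I ∷ I ∷ O ∷ O ∷ O ∷ O ∷ I ∷ I ∷ O ∷ O ∷ O ∷ [])
  ∷ (O ∷ I ∷ O ∷ O ∷ I ∷ O ∷ O ∷ I ∷ O ∷ O ∷ I ∷ O ∷ O ∷ I ∷ O ∷ O ∷ [])
  ∷ (O ∷ O ∷ I ∷ O ∷ I ∷ O ∷ O ∷ I ∷ O ∷ I ∷ O ∷ O ∷ O ∷ O ∷ I ∷ O ∷ [])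
  ∷ (O ∷ O ∷ O ∷ I ∷ O ∷ I ∷ I ∷ O ∷ I ∷ O ∷ O ∷ O ∷ O ∷ O ∷ O ∷ I ∷ [])
  ∷ (I ∷ O ∷ O ∷ O ∷ O ∷ O ∷ O ∷ I ∷ O ∷ I ∷ I ∷ O ∷ I ∷ O ∷ O ∷ O ∷ [])
  ∷ (O ∷ I ∷ O ∷ O ∷ O ∷ O ∷ I ∷ O ∷ I ∷ O ∷ O ∷ I ∷ O ∷ I ∷ O ∷ O ∷ [])
  ∷ (O ∷ O ∷ I ∷ O ∷ O ∷ I ∷ O ∷ O ∷ I ∷ O ∷ O ∷ I ∷ O ∷ O ∷ I ∷ O ∷ [])
  ∷ (O ∷ O ∷ O ∷ I ∷ I ∷ O ∷ O ∷ O ∷ O ∷ I ∷ I ∷ O ∷ O ∷ O ∷ O ∷ I ∷ [])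
  ∷ (O ∷ O ∷ O ∷ I ∷ I ∷ O ∷ O ∷ O ∷ I ∷ O ∷ O ∷ O ∷ O ∷ I ∷ I ∷ O ∷ [])
  ∷ (O ∷ O ∷ I ∷ O ∷ O ∷ I ∷ O ∷ O ∷ O ∷ I ∷ O ∷ O ∷ I ∷ O ∷ O ∷ I ∷ [])
  ∷ (O ∷ I ∷ O ∷ O ∷ O ∷ O ∷ I ∷ O ∷ O ∷ O ∷ I ∷ O ∷ I ∷ O ∷ O ∷ I ∷ [])
  ∷ (I ∷ O ∷ O ∷ O ∷ O ∷ O ∷ O ∷ I ∷ O ∷ O ∷ O ∷ I ∷ O ∷ I ∷ I ∷ O ∷ [])
  ∷ []
  where
  I = true
  O = false

_~?_ : ∀ x y → Dec (y ∈ lookup neighbours x)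
x ~? y = y ∈? lookup neighbours x

clebsch : FiniteGraph 16
clebsch .Adj x y = y ∈ lookup neighbours x
clebsch .symm {x} {y} = from-yes (all? λ x → all? λ y → (x ~? y) →-dec (y ~? x)) x y
clebsch .irrefl {x} refl = from-yes (all? λ x → ¬? (x ~? x)) x
clebsch .adj? = _~?_

clebsch-noPath : ¬ HasPath clebsch 5
clebsch-noPath = from-no (hasPath? clebsch 5)

-- With y = x + c, the word abcab started at `x` ends at `y`, so only paths from `x` need be
-- searched.
clebsch-delete : ∀ x y → Adj clebsch x y → Continues (deleteEdge clebsch x y) 5 x []
clebsch-delete = from-yes (all? λ x → all? λ y →
  adj? clebsch x y →-dec continues? (deleteEdge clebsch x y) 5 x [])

-- Searching only for paths that begin with the new edge keeps the evaluation small.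
clebsch-add : ∀ x y (x≢y : x ≢ y) → ¬ Adj clebsch x y →
              Continues (addEdge clebsch x y x≢y) 4 y (x ∷ [])
clebsch-add = from-yes (all? λ x → all? λ y → add? x y)
  where
  add? : ∀ x y → Dec ((x≢y : x ≢ y) → ¬ Adj clebsch x y →
                      Continues (addEdge clebsch x y x≢y) 4 y (x ∷ []))
  add? x y with x ≟ y
  ... | yes x≡y = yes λ x≢y → contradiction x≡y x≢y
  -- Adjacency in `addEdge` does not depend on the proof of `x ≢ y`, so a path found for one proof
  -- serves for all.
  ... | no x≢y  = map′ (λ path _ → path) (λ path → path x≢y)
    (¬? (adj? clebsch x y) →-dec continues? (addEdge clebsch x y x≢y) 4 y (x ∷ []))

theorem1 : Σ[ n ∈ ℕ ] (2 ≤ n × (Σ[ G ∈ FiniteGraph n ] InducedSaturated (Path 6) G))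
theorem1 = 16 , s≤s (s≤s z≤n) , clebsch , record
  { induced-free = clebsch-noPath ∘ contains⇒hasPath clebsch 5
  ; delete       = λ x y x~y → hasPath⇒contains (deleteEdge clebsch x y) 5
                     (x , clebsch-delete x y x~y)
  ; add          = λ x y x≢y x≁y → hasPath⇒contains (addEdge clebsch x y x≢y) 5
                     -- The new edge is the first of the five steps, with nothing earlier to avoid;
                     -- the search supplies the other four.
                     (x , y , inj₂ (inj₁ (refl , refl)) , [] , clebsch-add x y x≢y x≁y)
  }
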